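{- Let $\lambda\in\{1,2\}$ and let $u,t,v,w$ be integers such that: $(uw,t)$ satisfies $S_{\lambda,1}$ and $(uw)\cdot v=t^3+t^{\lambda}+1$ (so $uw,t,v$ are consecutive terms of $\langle uw,t\rangle_{S_{\lambda,1}}=\langle t,v\rangle_{S_{2,\lambda}}$); $(vw,t)$ satisfies $S_{\lambda,1}$ (so $vw,t,u$ are consecutive terms of $\langle vw,t\rangle_{S_{\lambda,1}}=\langle t,u\rangle_{S_{2,\lambda}}$); $|t|$ is a prime; and $t\nmid (u-v)$. Then $(-uv,t)$ satisfies $S_{\lambda,1}$, so $-uv,t,-w$ are, in that order, three consecutive terms of a third 4-chain $\langle -uv,t\rangle_{S_{\lambda,1}}=\langle t,-w\rangle_{S_{2,\lambda}}$.
   Context: For $\lambda_a,\lambda_b\in\{1,2\}$, a pair of integers $(x,y)$ satisfies the system $S_{\lambda_a,\lambda_b}$ if $x\mid y^3+y^{\lambda_a}+1$ and $y\mid x^3+x^{\lambda_b}+1$. For such a pair, $\langle x,y\rangle_{S_{\lambda_a,\lambda_b}}$ denotes the bi-infinite integer sequence $(u_n)$ with $u_0=x$, $u_1=y$ and $u_{n-1}u_{n+1}=u_n^3+u_n^{e_n}+1$ for all $n$, where $e_n$ has period 4 with $(e_0,e_1,e_2,e_3)=(\lambda_b,\lambda_a,3-\lambda_b,3-\lambda_a)$; sequences are identified up to shift and reversal of indices. "$u,t,s$, in that order, are three consecutive terms of $\langle u,t\rangle_{S_{\lambda_a,\lambda_b}}$" means $(u,t)$ satisfies $S_{\lambda_a,\lambda_b}$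 and $us=t^3+t^{\lambda_a}+1$. -}

module Defs where

open import Data.Nat using (ℕ; _∸_)
open import Data.Integer using (ℤ; _+_; _-_; _*_; _^_; 0ℤ; 1ℤ)
open import Data.Integer.DivMod using (_%ℕ_)
open import Data.Integer.Divisibility.Signed using (_∣_)
open import Data.Product using (_×_; ∃-syntax)
open import Data.Sum using (_⊎_)
open import Relation.Binary.PropositionalEquality using (_≡_)

cubic : ℕ → ℤ → ℤ
cubic e z = z ^ 3 + z ^ e + 1ℤ

-- (x , y) satisfies S_{a,b}.
Satisfies : (a b : ℕ) (x y : ℤ) → Set
Satisfies a b x y = x ∣ cubic a y × y ∣ cubic b x

-- The 4-periodic exponents (e₀ , e₁ , e₂ , e₃) = (b , a , 3 - b , 3 - a).
-- For a, b ∈ {1, 2} the truncated subtraction is exact.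
exponent : (a b : ℕ) → ℤ → ℕ
exponent a b n with n %ℕ 4
... | 0 = b
... | 1 = a
... | 2 = 3 ∸ b
... | _ = 3 ∸ a

-- The bi-infinite sequence f is a representative of ⟨ x , y ⟩ for S_{a,b},
-- indexed so that x and y are in positions 0 and 1.
record IsChain (a b : ℕ) (x y : ℤ) (f : ℤ → ℤ) : Set where
  field
    satisfies  : Satisfies a b x y
    at-0       : f 0ℤ ≡ x
    at-1       : f 1ℤ ≡ y
    recurrence : ∀ n → f (n - 1ℤ) * f (n + 1ℤ) ≡ cubic (exponent a b n) (f n)

-- Equality of bi-infinite sequences up to shift and reversal of indices.
_∼_ : (f g : ℤ → ℤ) → Set
f ∼ g = ∃[ k ] ((∀ n → g n ≡ f (n + k)) ⊎ (∀ n → g n ≡ f (k - n)))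

-- ⟨ x , y ⟩ for S_{a,b} and ⟨ x′ , y′ ⟩ for S_{a′,b′} exist and are equal.
-- `IsChain` is a relation, so existence is demanded explicitly: otherwise
-- `equal` could hold vacuously.
record SameChain (a b : ℕ) (x y : ℤ) (a′ b′ : ℕ) (x′ y′ : ℤ) : Set where
  field
    exists₁ : ∃[ f ] IsChain a b x y f
    exists₂ : ∃[ g ] IsChain a′ b′ x′ y′ g
    equal   : ∀ f g → IsChain a b x y f → IsChain a′ b′ x′ y′ g → f ∼ g

-- p , q , r are, in that order, consecutive terms of ⟨ p , q ⟩ for S_{a,b}.
ConsecutiveTerms : (a b : ℕ) (p q r : ℤ) → Set
ConsecutiveTerms a b p q r = Satisfies a b p q × p * r ≡ cubic a q

{-# OPTIONS --safe #-}

-- If x z = y³ + yᵃ + 1 then z is the inverse of x modulo y, so reversing the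
-- coefficients of X³ + Xᵇ + 1 shows that (y , z) satisfies S_{3-b,a}: this
-- extends chains to the right, and by symmetry to the left.  The extension is
-- unique because X³ + Xᵉ + 1 has no integer root, so that no term vanishes.
--
-- Modulo t, the hypotheses thus say that u and v are distinct roots of
-- X³ + X² + 1.  By Vieta the third root is - (1 + u + v), with inverse - u v,
-- hence - u v is a root of the reversed polynomial X³ + X + 1.
module Submission where

open import Defs
open import Data.Nat using (ℕ; zero; suc; _∸_)
import Data.Nat as ℕ
import Data.Nat.Properties as ℕ
import Data.Nat.Divisibility as ℕ
open import Data.Nat.Primality using (Prime; euclidsLemma)
open import Data.Integer using (ℤ; +_; -[1+_]; _+_; _*_; _-_; -_; ∣_∣; 0ℤ; 1ℤ; ≢-nonZero)
open import Data.Integer.Properties using (abs-*; *-comm; *-cancelˡ-≡)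
open import Data.Integer.Divisibility.Signed
  using (_∣_; divides; ∣ᵤ⇒∣; ∣⇒∣ᵤ; ∣m∣n⇒∣m+n; ∣m∣n⇒∣m-n; ∣n⇒∣m*n; ∣m⇒∣m*n)
open import Data.Integer.Tactic.RingSolver using (solve-∀)
open import Data.Product using (_×_; _,_)
open import Data.Sum using (_⊎_; inj₁; inj₂; [_,_]′)
import Data.Sum as Sum
open import Function using (_∘_)
open import Relation.Nullary using (¬_; contradiction)
open import Relation.Binary.PropositionalEquality
  using (_≡_; _≢_; refl; sym; trans; cong; cong₂; subst; subst₂)

-- Divisibility properties of X³ + Xᵉ + 1.

IsExponent : ℕ → Set
IsExponent e = e ≡ 1 ⊎ e ≡ 2

complement : ∀ {e} → IsExponent e → IsExponent (3 ∸ e)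
complement (inj₁ refl) = inj₂ refl
complement (inj₂ refl) = inj₁ refl

complement-involutive : ∀ {e} → IsExponent e → 3 ∸ (3 ∸ e) ≡ e
complement-involutive (inj₁ refl) = refl
complement-involutive (inj₂ refl) = refl

z∣cubic-1 : ∀ {e} → IsExponent e → ∀ z → z ∣ cubic e z - 1ℤ
z∣cubic-1 (inj₁ refl) z = divides (z * z + 1ℤ) (identity z)
  where
  identity : ∀ z → z * (z * (z * 1ℤ)) + z * 1ℤ + 1ℤ - 1ℤ ≡ (z * z + 1ℤ) * z
  identity = solve-∀
z∣cubic-1 (inj₂ refl) z = divides (z * z + z) (identity z)
  where
  identity : ∀ z → z * (z * (z * 1ℤ)) + z * (z * 1ℤ) + 1ℤ - 1ℤ ≡ (z * z + z) * z
  identity = solve-∀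

-- A root divides the constant term 1, hence is 1 or -1, and the values at these two points are odd.
cubic≢0 : ∀ {e} → IsExponent e → ∀ z → cubic e z ≢ 0ℤ
cubic≢0 {e} e∈ z root = noUnitRoot e∈ z ∣z∣≡1 root
  where
  ∣z∣≡1 : ∣ z ∣ ≡ 1
  ∣z∣≡1 = ℕ.∣1⇒≡1 (∣⇒∣ᵤ (subst (λ c → z ∣ c - 1ℤ) root (z∣cubic-1 e∈ z)))

  noUnitRoot : ∀ {e} → IsExponent e → ∀ z → ∣ z ∣ ≡ 1 → cubic e z ≢ 0ℤ
  noUnitRoot (inj₁ refl) (+ 1)    refl ()
  noUnitRoot (inj₁ refl) -[1+ 0 ] refl ()
  noUnitRoot (inj₂ refl) (+ 1)    refl ()
  noUnitRoot (inj₂ refl) -[1+ 0 ] refl ()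

-- X³ + X³⁻ᵇ + 1 is the reversal of X³ + Xᵇ + 1.
∣cubic-inverse : ∀ {b m} → IsExponent b → ∀ x z →
                 m ∣ x * z - 1ℤ → m ∣ cubic b x → m ∣ cubic (3 ∸ b) z
∣cubic-inverse {m = m} (inj₁ refl) x z inv root =
  subst (m ∣_) (sym (identity x z))
    -- The cofactor of `x * z - 1ℤ` comes from factoring (xz)³ - 1 and xz·z² - z²; in the other
    -- case, from (xz)³ - 1 and (xz)²·z - z.
    (∣m∣n⇒∣m-n (∣n⇒∣m*n (z * z * z) root)
               (∣m⇒∣m*n ((x * z) * (x * z) + x * z + 1ℤ + z * z) inv))
  where
  identity : ∀ x z →
    z * (z * (z * 1ℤ)) + z * (z * 1ℤ) + 1ℤ ≡
    z * z * z * (x * (x * (x * 1ℤ)) + x * 1ℤ + 1ℤ)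
      - (x * z - 1ℤ) * ((x * z) * (x * z) + x * z + 1ℤ + z * z)
  identity = solve-∀
∣cubic-inverse {m = m} (inj₂ refl) x z inv root =
  subst (m ∣_) (sym (identity x z))
    (∣m∣n⇒∣m-n (∣n⇒∣m*n (z * z * z) root)
               (∣m⇒∣m*n ((x * z) * (x * z) + x * z + 1ℤ + (x * z + 1ℤ) * z) inv))
  where
  identity : ∀ x z →
    z * (z * (z * 1ℤ)) + z * 1ℤ + 1ℤ ≡
    z * z * z * (x * (x * (x * 1ℤ)) + x * (x * 1ℤ) + 1ℤ)
      - (x * z - 1ℤ) * ((x * z) * (x * z) + x * z + 1ℤ + (x * z + 1ℤ) * z)
  identity = solve-∀

satisfies-next : ∀ {a b x y z} → IsExponent a → IsExponent b →
                 Satisfies a b x y → x * z ≡ cubic a y → Satisfies (3 ∸ b) a y z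
satisfies-next {a} {b} {x} {y} {z} a∈ b∈ (_ , y∣) xz≡ =
  ∣cubic-inverse b∈ x z (subst (λ c → y ∣ c - 1ℤ) (sym xz≡) (z∣cubic-1 a∈ y)) y∣ ,
  divides x (sym xz≡)

-- Symmetries of the exponent pattern.

-- `exponent a b (+ suc (suc (suc (suc n))))` and `exponent a b (+ n)` are
-- definitionally equal, and likewise for negative arguments.
exponent-shift : ∀ {b} a → IsExponent b → ∀ n →
                 exponent (3 ∸ b) a n ≡ exponent a b (n + 1ℤ)
exponent-shift a b∈ (+ 0) = refl
exponent-shift a b∈ (+ 1) = refl
exponent-shift a b∈ (+ 2) = refl
exponent-shift a b∈ (+ 3) = complement-involutive b∈
exponent-shift a b∈ (+ suc (suc (suc (suc n)))) = exponent-shift a b∈ (+ n)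
exponent-shift a b∈ -[1+ 0 ] = complement-involutive b∈
exponent-shift a b∈ -[1+ 1 ] = refl
exponent-shift a b∈ -[1+ 2 ] = refl
exponent-shift a b∈ -[1+ 3 ] = refl
exponent-shift a b∈ -[1+ 4 ] = complement-involutive b∈
-- The recursion must not reach -1, whose successor is no longer negative.
exponent-shift a b∈ -[1+ suc (suc (suc (suc (suc n)))) ] = exponent-shift a b∈ -[1+ suc n ]

-- Swapping positions 0 and 1 is the reflection of indices n ↦ 1 - n.
exponent-reflect : ∀ a b n → exponent b a n ≡ exponent a b (1ℤ - n)
exponent-reflect a b (+ 0) = refl
exponent-reflect a b (+ 1) = refl
exponent-reflect a b (+ 2) = refl
exponent-reflect a b (+ 3) = refl
exponent-reflect a b (+ 4) = refl
exponent-reflect a b (+ 5) = refl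
exponent-reflect a b (+ suc (suc (suc (suc (suc (suc n)))))) = exponent-reflect a b (+ suc (suc n))
exponent-reflect a b -[1+ 0 ] = refl
exponent-reflect a b -[1+ 1 ] = refl
exponent-reflect a b -[1+ 2 ] = refl
exponent-reflect a b -[1+ 3 ] = refl
exponent-reflect a b -[1+ suc (suc (suc (suc n))) ] = exponent-reflect a b -[1+ n ]

-- Existence of chains.

record Seed : Set where
  field
    {a b}     : ℕ
    {x y}     : ℤ
    a∈        : IsExponent a
    b∈        : IsExponent b
    satisfies : Satisfies a b x y

-- The new term is the quotient `z` stored in the witness of `x ∣ cubic a y`, so no division is
-- performed.
next : Seed → Seed
next record { x = x ; a∈ = a∈ ; b∈ = b∈ ; satisfies = sat@(divides z eq , _) } = record
  { a∈ = complement b∈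
  ; b∈ = a∈
  ; satisfies = satisfies-next a∈ b∈ sat (trans (*-comm x z) (sym eq))
  }

reverse : Seed → Seed
reverse record { a∈ = a∈ ; b∈ = b∈ ; satisfies = x∣ , y∣ } = record
  { a∈ = b∈ ; b∈ = a∈ ; satisfies = y∣ , x∣ }

forward : Seed → ℕ → ℤ
forward s zero    = Seed.x s
forward s (suc n) = forward (next s) n

forward-recurrence : ∀ s n → forward s n * forward s (2 ℕ.+ n) ≡
                     cubic (exponent (Seed.a s) (Seed.b s) (+ suc n)) (forward s (suc n))
forward-recurrence record { x = x ; satisfies = (divides z eq , _) } zero =
  trans (*-comm x z) (sym eq)
forward-recurrence s (suc n) = trans (forward-recurrence (next s) n)
  (cong (λ e → cubic e (forward s (2 ℕ.+ n)))
    (trans (exponent-shift a b∈ (+ suc n)) (cong (exponent a b ∘ +_ ∘ suc) (ℕ.+-comm n 1))))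
  where open Seed s

sequence : Seed → ℤ → ℤ
sequence s (+ n)    = forward s n
-- The reversed seed has `y` and `x` in positions 0 and 1, so index -1 is its position 2.
sequence s -[1+ n ] = forward (reverse s) (2 ℕ.+ n)

sequence-isChain : ∀ s → IsChain (Seed.a s) (Seed.b s) (Seed.x s) (Seed.y s) (sequence s)
sequence-isChain s = record
  { satisfies = satisfies ; at-0 = refl ; at-1 = refl ; recurrence = recurrence }
  where
  open Seed s

  backward-recurrence : ∀ n →
    forward (reverse s) (2 ℕ.+ n) * forward (reverse s) n ≡
    cubic (exponent a b (1ℤ - + suc n)) (forward (reverse s) (suc n))
  backward-recurrence n =
    trans (*-comm (forward (reverse s) (2 ℕ.+ n)) (forward (reverse s) n))
      (trans (forward-recurrence (reverse s) n)
        (cong (λ e → cubic e (forward (reverse s) (suc n))) (exponent-reflect a b (+ suc n))))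

  recurrence : ∀ n → sequence s (n - 1ℤ) * sequence s (n + 1ℤ) ≡
               cubic (exponent a b n) (sequence s n)
  recurrence (+ zero)  = backward-recurrence 0
  recurrence (+ suc n) rewrite ℕ.+-comm n 1 = forward-recurrence s n
  recurrence -[1+ zero ] = backward-recurrence 1
  recurrence -[1+ suc n ] rewrite ℕ.+-identityʳ n = backward-recurrence (2 ℕ.+ n)

-- Uniqueness of chains.

shift-isChain : ∀ {a b x y f} → IsExponent a → IsExponent b → IsChain a b x y f →
                IsChain (3 ∸ b) a y (f (+ 2)) (λ n → f (n + 1ℤ))
shift-isChain {a} {b} {f = f} a∈ b∈ c = record
  { satisfies  = satisfies-next a∈ b∈ satisfies
      (trans (cong (_* f (+ 2)) (sym at-0))
             (trans (recurrence 1ℤ) (cong (cubic a) at-1)))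
  ; at-0       = at-1
  ; at-1       = refl
  ; recurrence = λ n → trans
      (cong (λ k → f k * f (n + 1ℤ + 1ℤ)) (swap n))
      (trans (recurrence (n + 1ℤ))
             (cong (λ e → cubic e (f (n + 1ℤ))) (sym (exponent-shift a b∈ n))))
  }
  where
  open IsChain c
  swap : ∀ n → n - 1ℤ + 1ℤ ≡ n + 1ℤ - 1ℤ
  swap = solve-∀

reflect-isChain : ∀ {a b x y f} → IsChain a b x y f →
                  IsChain b a y x (λ n → f (1ℤ - n))
reflect-isChain {a} {b} {f = f} c = record
  { satisfies  = let (x∣ , y∣) = satisfies in y∣ , x∣
  ; at-0       = at-1
  ; at-1       = at-0
  ; recurrence = λ n → trans
      (cong₂ (λ j k → f j * f k) (left n) (right n))
      (trans (*-comm (f (1ℤ - n + 1ℤ)) (f (1ℤ - n - 1ℤ)))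
        (trans (recurrence (1ℤ - n))
               (cong (λ e → cubic e (f (1ℤ - n))) (sym (exponent-reflect a b n)))))
  }
  where
  open IsChain c
  left : ∀ n → 1ℤ - (n - 1ℤ) ≡ 1ℤ - n + 1ℤ
  left = solve-∀
  right : ∀ n → 1ℤ - (n + 1ℤ) ≡ 1ℤ - n - 1ℤ
  right = solve-∀

-- Cancelling `x` is allowed: if it were 0, then `y` would be an integer root.
next-unique : ∀ {a} → IsExponent a → ∀ x y {z z′} →
              x * z ≡ cubic a y → x * z′ ≡ cubic a y → z ≡ z′
next-unique a∈ x y {z} {z′} xz≡ xz′≡ =
  *-cancelˡ-≡ x z z′ {{≢-nonZero x≢0}} (trans xz≡ (sym xz′≡))
  where
  x≢0 : x ≢ 0ℤ
  x≢0 refl = cubic≢0 a∈ y (sym xz≡)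

chain-next : ∀ {a b x y f} → IsChain a b x y f → x * f (+ 2) ≡ cubic a y
chain-next {a} {f = f} c =
  subst₂ (λ x y → x * f (+ 2) ≡ cubic a y) at-0 at-1 (recurrence 1ℤ)
  where open IsChain c

isChain-unique : ∀ {a b x y f g} → IsExponent a → IsExponent b →
                 IsChain a b x y f → IsChain a b x y g → ∀ n → f n ≡ g n
isChain-unique a∈ b∈ cf cg = λ where
    (+ n)    → unique⁺ n a∈ b∈ cf cg
    -[1+ n ] → unique⁺ (2 ℕ.+ n) b∈ a∈ (reflect-isChain cf) (reflect-isChain cg)
  where
  unique⁺ : ∀ {a b x y f g} n → IsExponent a → IsExponent b →
            IsChain a b x y f → IsChain a b x y g → f (+ n) ≡ g (+ n)
  unique⁺ zero a∈ b∈ cf cg = trans (IsChain.at-0 cf) (sym (IsChain.at-0 cg))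
  unique⁺ {a} {b} {x} {y} {f} {g} (suc n) a∈ b∈ cf cg =
    subst (λ k → f (+ k) ≡ g (+ k)) (ℕ.+-comm n 1)
      (unique⁺ n (complement b∈) a∈ (shift-isChain a∈ b∈ cf)
        -- The shifted chains start at `y , f (+ 2)` and `y , g (+ 2)`, which must be identified
        -- before the induction hypothesis applies.
        (subst (λ z → IsChain (3 ∸ b) a y z (λ k → g (k + 1ℤ)))
          (next-unique a∈ x y (chain-next cg) (chain-next cf))
          (shift-isChain a∈ b∈ cg)))

consecutive⇒sameChain : ∀ {a b p q r} → IsExponent a → IsExponent b →
                        ConsecutiveTerms a b p q r → SameChain a b p q (3 ∸ b) a q r
consecutive⇒sameChain {a} {b} {p} {q} a∈ b∈ (sat , pr≡) = record
  { exists₁ = _ , sequence-isChain (record { a∈ = a∈ ; b∈ = b∈ ; satisfies = sat })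
  ; exists₂ = _ , sequence-isChain (record
      { a∈ = complement b∈ ; b∈ = a∈ ; satisfies = satisfies-next a∈ b∈ sat pr≡ })
  -- The shift is by 1, without reversal: `q` and `r` are in positions 1 and 2 of `f`.
  ; equal = λ f g cf cg → 1ℤ , inj₁ (isChain-unique (complement b∈) a∈ cg
      (subst (λ z → IsChain (3 ∸ b) a q z (λ n → f (n + 1ℤ)))
        (next-unique a∈ p q (chain-next cf) pr≡)
        (shift-isChain a∈ b∈ cf)))
  }

-- Roots modulo a prime, and the third chain.

prime∣* : ∀ {p} → Prime ∣ p ∣ → ∀ m n → p ∣ (m * n) → (p ∣ m) ⊎ (p ∣ n)
prime∣* {p} pp m n p∣mn = Sum.map ∣ᵤ⇒∣ ∣ᵤ⇒∣
  (euclidsLemma ∣ m ∣ ∣ n ∣ pp (subst (∣ p ∣ ℕ.∣_) (abs-* m n) (∣⇒∣ᵤ p∣mn)))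

-- The quadratic factor of the hypothesis is the divided difference of
-- X³ + X² + 1 at u and v.
∣cubic-third-root : ∀ {p} → Prime ∣ p ∣ → ∀ u v → ¬ (p ∣ (u - v)) →
                    p ∣ cubic 2 u → p ∣ cubic 2 v → p ∣ cubic 1 (- (u * v))
∣cubic-third-root {p} pp u v p∤u-v p∣u p∣v =
  [ (λ p∣u-v → contradiction p∣u-v p∤u-v) , combine ]′
    (prime∣* pp (u - v) q (subst (p ∣_) (difference u v) (∣m∣n⇒∣m-n p∣u p∣v)))
  where
  q : ℤ
  q = u * u + u * v + v * v + u + v

  difference : ∀ u v →
    (u * (u * (u * 1ℤ)) + u * (u * 1ℤ) + 1ℤ) - (v * (v * (v * 1ℤ)) + v * (v * 1ℤ) + 1ℤ) ≡
    (u - v) * (u * u + u * v + v * v + u + v)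
  difference = solve-∀

  -- With s = u + v and m = u v, the relations modulo p are m ≡ s (s + 1)
  -- and m (s + 1) ≡ 1.
  identity : ∀ u v →
    - (u * v) * (- (u * v) * (- (u * v) * 1ℤ)) + - (u * v) * 1ℤ + 1ℤ ≡
    (1ℤ + u * v * (u + v)) * (u * (u * (u * 1ℤ)) + u * (u * 1ℤ) + 1ℤ)
      + (u * v * (u * v) - u * (1ℤ + u * v * (u + v))) * (u * u + u * v + v * v + u + v)
  identity = solve-∀

  combine : p ∣ q → p ∣ cubic 1 (- (u * v))
  combine p∣q = subst (p ∣_) (sym (identity u v))
    (∣m∣n⇒∣m+n (∣n⇒∣m*n (1ℤ + u * v * (u + v)) p∣u)
               (∣n⇒∣m*n (u * v * (u * v) - u * (1ℤ + u * v * (u + v))) p∣q))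

theorem13 : (l : ℕ) → l ≡ 1 ⊎ l ≡ 2 →
    (u t v w : ℤ) →
    ConsecutiveTerms l 1 (u * w) t v →
    Satisfies l 1 (v * w) t →
    Prime ∣ t ∣ →
    ¬ (t ∣ (u - v)) →
    Satisfies l 1 (- (u * v)) t ×
    ConsecutiveTerms l 1 (- (u * v)) t (- w) ×
    SameChain l 1 (- (u * v)) t 2 l t (- w)
theorem13 l l∈ u t v w (sat₁ , uwv≡) sat₂ tp t∤u-v =
  sat , consecutive , consecutive⇒sameChain l∈ (inj₁ refl) consecutive
  where
  vwu≡uwv : ∀ u v w → v * w * u ≡ u * w * v
  vwu≡uwv = solve-∀

  uvw≡uwv : ∀ u v w → - (u * v) * - w ≡ u * w * v
  uvw≡uwv = solve-∀

  t∣v : t ∣ cubic 2 v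
  t∣v = let (t∣ , _) = satisfies-next l∈ (inj₁ refl) sat₁ uwv≡ in t∣

  t∣u : t ∣ cubic 2 u
  -- The same factorization of `cubic l t`, regrouped, makes `u` the term after `v * w , t`.
  t∣u = let (t∣ , _) = satisfies-next l∈ (inj₁ refl) sat₂ (trans (vwu≡uwv u v w) uwv≡) in t∣

  product≡ : - (u * v) * - w ≡ cubic l t
  product≡ = trans (uvw≡uwv u v w) uwv≡

  sat : Satisfies l 1 (- (u * v)) t
  sat = divides (- w) (trans (sym product≡) (*-comm (- (u * v)) (- w))) ,
        ∣cubic-third-root tp u v t∤u-v t∣u t∣v

  consecutive : ConsecutiveTerms l 1 (- (u * v)) t (- w)
  consecutive = sat , product≡
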